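{- Let $\mathcal{C}$ be a complete category, $H : \mathcal{C} \Rightarrow \mathsf{Set}$ any functor, and $\mathcal{C}'$ the extended base category corresponding to $H$, with forgetful functor $V_H : \mathcal{C}' \Rightarrow \mathcal{C}$. Then the base target functor $U_H : \int_{\mathcal{C}'} (H \circ V_H) \Rightarrow \mathsf{Set}$, given on objects by $U_H(X,P,x) = P(x)$, is continuous relative to the forgetful functor $\int_{\mathcal{C}'} (H \circ V_H) \Rightarrow \mathcal{C}'$.
   Context: Work in Martin-Löf type theory with function extensionality; $\mathsf{Set}$ is the universe/category of sets (types satisfying UIP). The extended base category $\mathcal{C}'$ has objects pairs $(X,P)$ with $X$ an object of $\mathcal{C}$ and $P : H(X) \to \mathsf{Set}$, and morphisms $(f,g) : (X,P) \to (Y,Q)$ with $f : X \to Y$ in $\mathcal{C}$ and $g : (x : H(X)) \to P(x) \to Q(H(f)\,x)$; $V_H(X,P) = X$. For $K : \mathcal{D} \Rightarrow \mathsf{Set}$, the category of elements $\int_{\mathcal{D}} K$ has objects $(D,d)$ with $d : K D$ and morphisms $f : D \to D'$ with $K(f)\,d = d'$; objects of $\int_{\mathcal{C}'}(H \circ V_H)$ are thus triples $(X,P,x)$ with $x : H X$. $U_H$ acts on a morphism $(f,g)$ from $(X,P,x)$ by $g(x) : P(x) \to Q(H(f)\,x)$. Relative continuity: for $U : \mathcal{D} \Rightarrow \mathcal{D}_0$ with $\mathcal{D}_0$ complete, a cone over a small diagram in $\mathcal{D}$ is a $U$-limit cone if $U$ maps it to a limit cone; a functor $\mathcal{D} \Rightarrow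 \mathsf{Set}$ is continuous relative to $U$ if it maps $U$-limit cones to limit cones in $\mathsf{Set}$. -}

module Defs where

open import Level using (Level; _⊔_; Setω) renaming (suc to lsuc)
open import Axiom.Extensionality.Propositional using (Extensionality)
open import Data.Product using (Σ; Σ-syntax; _,_; proj₁; proj₂)
open import Relation.Binary.PropositionalEquality using (_≡_; refl; sym; trans; cong; cong-app; subst)
open import Relation.Binary.HeterogeneousEquality using (_≅_; ≅-to-≡; ≡-to-≅; ≡-subst-removable) renaming (refl to hrefl; sym to hsym; trans to htrans)

-- Axiom K is available here, so every type in `Set ℓ` satisfies UIP.  Hence
-- `Set ℓ` itself plays the role of the universe of sets, and hom-types need
-- no separate UIP field.

FunExt : Setω
FunExt = ∀ {a b : Level} → Extensionality a b

record Category (o h : Level) : Set (lsuc (o ⊔ h)) where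
  infixr 9 _∘_
  field
    Obj   : Set o
    Hom   : Obj → Obj → Set h
    id    : ∀ {X} → Hom X X
    _∘_   : ∀ {X Y Z} → Hom Y Z → Hom X Y → Hom X Z
    idˡ   : ∀ {X Y} (f : Hom X Y) → id ∘ f ≡ f
    idʳ   : ∀ {X Y} (f : Hom X Y) → f ∘ id ≡ f
    assoc : ∀ {W X Y Z} (k : Hom Y Z) (g : Hom X Y) (f : Hom W X) →
            (k ∘ g) ∘ f ≡ k ∘ (g ∘ f)

record Functor {o h o′ h′ : Level} (C : Category o h) (D : Category o′ h′) :
               Set (o ⊔ h ⊔ o′ ⊔ h′) where
  private
    module C = Category C
    module D = Category D
  field
    F₀   : C.Obj → D.Obj
    F₁   : ∀ {X Y} → C.Hom X Y → D.Hom (F₀ X) (F₀ Y)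
    F-id : ∀ {X} → F₁ (C.id {X}) ≡ D.id
    F-∘  : ∀ {X Y Z} (g : C.Hom Y Z) (f : C.Hom X Y) →
           F₁ (g C.∘ f) ≡ F₁ g D.∘ F₁ f

infixr 9 _∘F_
_∘F_ : ∀ {o h o′ h′ o″ h″ : Level}
       {C : Category o h} {D : Category o′ h′} {E : Category o″ h″} →
       Functor D E → Functor C D → Functor C E
G ∘F F = record
  { F₀   = λ X → G.F₀ (F.F₀ X)
  ; F₁   = λ f → G.F₁ (F.F₁ f)
  ; F-id = trans (cong G.F₁ F.F-id) G.F-id
  ; F-∘  = λ g f → trans (cong G.F₁ (F.F-∘ g f)) (G.F-∘ (F.F₁ g) (F.F₁ f))
  }
  where
    module G = Functor G
    module F = Functor F

Sets : (ℓ : Level) → Category (lsuc ℓ) ℓ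
Sets ℓ = record
  { Obj   = Set ℓ
  ; Hom   = λ A B → A → B
  ; id    = λ a → a
  ; _∘_   = λ g f a → g (f a)
  ; idˡ   = λ _ → refl
  ; idʳ   = λ _ → refl
  ; assoc = λ _ _ _ → refl
  }

module _ {i o h : Level} {J : Category i i} {D : Category o h} where
  private
    module J = Category J
    module D = Category D

  record Cone (F : Functor J D) : Set (i ⊔ o ⊔ h) where
    open Functor F
    field
      apex     : D.Obj
      leg      : ∀ j → D.Hom apex (F₀ j)
      leg-comm : ∀ {j k} (u : J.Hom j k) → F₁ u D.∘ leg j ≡ leg k

  record IsLimit {F : Functor J D} (c : Cone F) : Set (i ⊔ o ⊔ h) where
    open Cone
    field
      mediate : ∀ (d : Cone F) → D.Hom (apex d) (apex c)
      factor  : ∀ (d : Cone F) j → leg c j D.∘ mediate d ≡ leg d j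
      unique  : ∀ (d : Cone F) (m : D.Hom (apex d) (apex c)) →
                (∀ j → leg c j D.∘ m ≡ leg d j) → m ≡ mediate d

mapCone : ∀ {i o h o′ h′ : Level}
          {J : Category i i} {D : Category o h} {E : Category o′ h′}
          (G : Functor D E) {F : Functor J D} → Cone F → Cone (G ∘F F)
mapCone G c = record
  { apex     = G.F₀ apex
  ; leg      = λ j → G.F₁ (leg j)
  ; leg-comm = λ u → trans (sym (G.F-∘ _ _)) (cong G.F₁ (leg-comm u))
  }
  where
    module G = Functor G
    open Cone c

-- "Small" means that objects and morphisms of the diagram shape live in `Set ℓ`.
Complete : ∀ (ℓ : Level) {o h : Level} → Category o h → Set (lsuc ℓ ⊔ o ⊔ h)
Complete ℓ D = ∀ (J : Category ℓ ℓ) (F : Functor J D) → Σ[ c ∈ Cone F ] IsLimit c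

module _ {ℓ o h o′ h′ : Level} {D : Category o h} {D₀ : Category o′ h′}
         (U : Functor D D₀) where

  IsRelativeLimit : {J : Category ℓ ℓ} {F : Functor J D} → Cone F → Set (ℓ ⊔ o′ ⊔ h′)
  IsRelativeLimit c = IsLimit (mapCone U c)

  -- The completeness argument only records that the notion is reserved for
  -- complete D₀; the defining condition does not mention it.
  ContinuousRelativeTo : Complete ℓ D₀ → Functor D (Sets ℓ) →
                         Set (lsuc ℓ ⊔ o ⊔ h ⊔ o′ ⊔ h′)
  ContinuousRelativeTo _ G =
    ∀ (J : Category ℓ ℓ) (F : Functor J D) (c : Cone F) →
    IsRelativeLimit c → IsLimit (mapCone G c)

module _ {ℓ o h : Level} {D : Category o h} (K : Functor D (Sets ℓ)) where
  private
    module D = Category D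
    module K = Functor K

  El : Set (o ⊔ ℓ)
  El = Σ D.Obj K.F₀

  ElHom : El → El → Set (h ⊔ ℓ)
  ElHom (X , x) (Y , y) = Σ[ f ∈ D.Hom X Y ] K.F₁ f x ≡ y

  ElHom-≡ : ∀ {A B : El} {f g : ElHom A B} → proj₁ f ≡ proj₁ g → f ≡ g
  ElHom-≡ {f = f , refl} {g = .f , refl} refl = refl

  Elements : Category (o ⊔ ℓ) (h ⊔ ℓ)
  Elements = record
    { Obj   = El
    ; Hom   = ElHom
    ; id    = D.id , cong-app K.F-id _
    ; _∘_   = λ (g , q) (f , p) →
                g D.∘ f , trans (cong-app (K.F-∘ g f) _) (trans (cong (K.F₁ g) p) q)
    ; idˡ   = λ (f , _) → ElHom-≡ (D.idˡ f)
    ; idʳ   = λ (f , _) → ElHom-≡ (D.idʳ f)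
    ; assoc = λ (k , _) (g , _) (f , _) → ElHom-≡ (D.assoc k g f)
    }

  forget : Functor Elements D
  forget = record
    { F₀   = proj₁
    ; F₁   = proj₁
    ; F-id = refl
    ; F-∘  = λ _ _ → refl
    }

module ExtendedBase (ext : FunExt) {ℓ o h : Level} {C : Category o h}
                    (H : Functor C (Sets ℓ)) where
  private
    module C = Category C
    module H = Functor H

    H-id : ∀ {X} (x : H.F₀ X) → H.F₁ C.id x ≡ x
    H-id = cong-app H.F-id

    H-∘ : ∀ {X Y Z} (g : C.Hom Y Z) (f : C.Hom X Y) (x : H.F₀ X) →
          H.F₁ (g C.∘ f) x ≡ H.F₁ g (H.F₁ f x)
    H-∘ g f = cong-app (H.F-∘ g f)

  ExtObj : Set (o ⊔ lsuc ℓ)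
  ExtObj = Σ[ X ∈ C.Obj ] (H.F₀ X → Set ℓ)

  ExtHom : ExtObj → ExtObj → Set (h ⊔ ℓ)
  ExtHom (X , P) (Y , Q) = Σ[ f ∈ C.Hom X Y ] (∀ x → P x → Q (H.F₁ f x))

  ext-id : ∀ {A} → ExtHom A A
  ext-id {X , P} = C.id , λ x p → subst P (sym (H-id x)) p

  ext-∘ : ∀ {A B D} → ExtHom B D → ExtHom A B → ExtHom A D
  ext-∘ {D = Z , R} (f′ , g′) (f , g) =
    f′ C.∘ f , λ x p → subst R (sym (H-∘ f′ f x)) (g′ (H.F₁ f x) (g x p))

  ExtHom-≡ : ∀ {A B} {m n : ExtHom A B} → proj₁ m ≡ proj₁ n →
             (∀ x p → proj₂ m x p ≅ proj₂ n x p) → m ≡ n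
  ExtHom-≡ {m = f , _} refl e =
    cong (f ,_) (ext λ x → ext λ p → ≅-to-≡ (e x p))

  fibre-≅ : ∀ {A B} {m n : ExtHom A B} → m ≡ n →
            ∀ x p → proj₂ m x p ≅ proj₂ n x p
  fibre-≅ refl x p = hrefl

  id-≅ : ∀ {A : ExtObj} (x : H.F₀ (proj₁ A)) (p : proj₂ A x) →
         proj₂ (ext-id {A}) x p ≅ p
  id-≅ {X , P} x p = ≡-subst-removable P (sym (H-id x)) p

  ∘-≅ : ∀ {A B D : ExtObj} (n : ExtHom B D) (m : ExtHom A B) x p →
        proj₂ (ext-∘ {A} {B} {D} n m) x p
          ≅ proj₂ n (H.F₁ (proj₁ m) x) (proj₂ m x p)
  ∘-≅ {D = Z , R} n m x p = ≡-subst-removable R (sym (H-∘ (proj₁ n) (proj₁ m) x)) _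

  app-≅ : ∀ {A B : ExtObj} (m : ExtHom A B) {x y} {p : proj₂ A x} {q : proj₂ A y} →
          x ≡ y → p ≅ q → proj₂ m x p ≅ proj₂ m y q
  app-≅ m refl hrefl = hrefl

  C′ : Category (o ⊔ lsuc ℓ) (h ⊔ ℓ)
  C′ = record
    { Obj   = ExtObj
    ; Hom   = ExtHom
    ; id    = λ {A} → ext-id {A}
    ; _∘_   = λ {A} {B} {D} → ext-∘ {A} {B} {D}
    ; idˡ   = λ {A} {B} m → ExtHom-≡ {A} {B} (C.idˡ (proj₁ m)) λ x p →
                htrans (∘-≅ {A} {B} {B} (ext-id {B}) m x p) (id-≅ {B} _ _)
    ; idʳ   = λ {A} {B} m → ExtHom-≡ {A} {B} (C.idʳ (proj₁ m)) λ x p →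
                htrans (∘-≅ {A} {A} {B} m (ext-id {A}) x p)
                       (app-≅ {A} {B} m (H-id x) (id-≅ {A} x p))
    ; assoc = λ {A} {B} {D} {E} k n m →
                ExtHom-≡ {A} {E} (C.assoc (proj₁ k) (proj₁ n) (proj₁ m)) λ x p →
                htrans (∘-≅ {A} {B} {E} (ext-∘ {B} {D} {E} k n) m x p)
               (htrans (∘-≅ {B} {D} {E} k n _ _)
               (htrans (app-≅ {D} {E} k (sym (H-∘ (proj₁ n) (proj₁ m) x))
                                  (hsym (∘-≅ {A} {B} {D} n m x p)))
                       (hsym (∘-≅ {A} {D} {E} k (ext-∘ {A} {B} {D} n m) x p))))
    }

  Vᴴ : Functor C′ C
  Vᴴ = record
    { F₀   = proj₁
    ; F₁   = proj₁
    ; F-id = refl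
    ; F-∘  = λ _ _ → refl
    }

  -- On ((f , g) , e : H f x ≡ y) the map g x : P x → Q (H f x) is transported
  -- along e so as to land in Q y.
  Uᴴ : Functor (Elements (H ∘F Vᴴ)) (Sets ℓ)
  Uᴴ = record
    { F₀   = λ ((_ , P) , x) → P x
    ; F₁   = λ {A} {B} → U₁ {A} {B}
    ; F-id = λ {A} → ext λ p →
               ≅-to-≡ (htrans (U₁-≅ {A} {A} (E.id {A}) p) (id-≅ {proj₁ A} (proj₂ A) p))
    ; F-∘  = λ {A} {B} {D} n m → ext λ p →
               ≅-to-≡ (htrans (U₁-≅ {A} {D} (E._∘_ {A} {B} {D} n m) p)
                      (htrans (∘-≅ {proj₁ A} {proj₁ B} {proj₁ D} (proj₁ n) (proj₁ m) (proj₂ A) p)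
                      (htrans (app-≅ {proj₁ B} {proj₁ D} (proj₁ n) (proj₂ m) (hsym (U₁-≅ {A} {B} m p)))
                              (hsym (U₁-≅ {B} {D} n (U₁ {A} {B} m p))))))
    }
    where
      module E = Category (Elements (H ∘F Vᴴ))

      U₁ : ∀ {A B : E.Obj} → E.Hom A B → proj₂ (proj₁ A) (proj₂ A) → proj₂ (proj₁ B) (proj₂ B)
      U₁ {(_ , P) , x} {(_ , Q) , y} ((f , g) , e) p = subst Q e (g x p)

      U₁-≅ : ∀ {A B : E.Obj} (m : E.Hom A B) (p : proj₂ (proj₁ A) (proj₂ A)) →
             U₁ {A} {B} m p ≅ proj₂ (proj₁ m) (proj₂ A) p
      U₁-≅ {(_ , P) , x} {(_ , Q) , y} ((f , g) , e) p = ≡-subst-removable Q e (g x p)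

  -- The limit of a diagram (Xⱼ , Pⱼ) is (X , P) with X = lim Xⱼ in C and P x
  -- the set of compatible families in Pⱼ (H πⱼ x).
  C′-complete : Complete ℓ C → Complete ℓ C′
  C′-complete C-complete J F = limCone , record
    { mediate = med
    ; factor  = λ d j → ExtHom-≡ {_} {F.F₀ j} (L.factor (base d) j) λ y q →
                  htrans (∘-≅ {_} {lim} {F.F₀ j} (π j) (med d) y q)
                         (comp-≅ d j y q)
    ; unique  = λ d m e →
                  π-monic {Cone.apex d} m (med d)
                    (L.unique (base d) (proj₁ m) λ j → cong proj₁ (e j))
                    λ j y q →
                      htrans (hsym (∘-≅ {_} {lim} {F.F₀ j} (π j) m y q))
                     (htrans (fibre-≅ {_} {F.F₀ j} (e j) y q)
                             (hsym (comp-≅ d j y q)))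
    }
    where
      module J = Category J
      module F = Functor F

      c : Cone (Vᴴ ∘F F)
      c = proj₁ (C-complete J (Vᴴ ∘F F))

      module c = Cone c
      module L = IsLimit (proj₂ (C-complete J (Vᴴ ∘F F)))

      Compatible : ∀ x → (∀ j → proj₂ (F.F₀ j) (H.F₁ (c.leg j) x)) → Set ℓ
      Compatible x p = ∀ i j (u : J.Hom i j) →
        proj₂ (F.F₁ u) (H.F₁ (c.leg i) x) (p i) ≅ p j

      lim : ExtObj
      lim = c.apex , λ x → Σ (∀ j → proj₂ (F.F₀ j) (H.F₁ (c.leg j) x)) (Compatible x)

      π : ∀ j → ExtHom lim (F.F₀ j)
      π j = c.leg j , λ x p → proj₁ p j

      limCone : Cone F
      limCone = record
        { apex     = lim
        ; leg      = π
        ; leg-comm = λ {i} {j} u → ExtHom-≡ {lim} {F.F₀ j} (c.leg-comm u) λ x p →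
                       htrans (∘-≅ {lim} {F.F₀ i} {F.F₀ j} (F.F₁ u) (π i) x p)
                              (proj₂ p i j u)
        }

      ≅-irr : ∀ {A B : Set ℓ} {a : A} {b : B} (p q : a ≅ b) → p ≡ q
      ≅-irr hrefl hrefl = refl

      fam-≡ : ∀ {x} {p q : proj₂ lim x} → (∀ j → proj₁ p j ≅ proj₁ q j) → p ≡ q
      fam-≡ {x} {p , r} {q , s} e with ext {f = p} {g = q} (λ j → ≅-to-≡ (e j))
      ... | refl = cong (p ,_) (ext λ i → ext λ j → ext λ u → ≅-irr (r i j u) (s i j u))

      π-monic : ∀ {A} (m n : ExtHom A lim) → proj₁ m ≡ proj₁ n →
                (∀ j x p → proj₁ (proj₂ m x p) j ≅ proj₁ (proj₂ n x p) j) → m ≡ n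
      π-monic {A} m n refl e =
        ExtHom-≡ {A} {lim} refl λ x p → ≡-to-≅ (fam-≡ λ j → e j x p)

      base : Cone F → Cone (Vᴴ ∘F F)
      base d = mapCone Vᴴ d

      module _ (d : Cone F) where
        private
          module d = Cone d

        point : ∀ j y → H.F₁ (proj₁ (d.leg j)) y
                          ≡ H.F₁ (c.leg j) (H.F₁ (L.mediate (base d)) y)
        point j y = trans (sym (cong (λ f → H.F₁ f y) (L.factor (base d) j)))
                          (H-∘ (c.leg j) (L.mediate (base d)) y)

        comp : ∀ j y (q : proj₂ d.apex y) →
               proj₂ (F.F₀ j) (H.F₁ (c.leg j) (H.F₁ (L.mediate (base d)) y))
        comp j y q = subst (proj₂ (F.F₀ j)) (point j y) (proj₂ (d.leg j) y q)

        comp-≅ : ∀ j y (q : proj₂ d.apex y) → comp j y q ≅ proj₂ (d.leg j) y q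
        comp-≅ j y q = ≡-subst-removable (proj₂ (F.F₀ j)) (point j y) _

        med : ExtHom d.apex lim
        med = L.mediate (base d) , λ y q → (λ j → comp j y q) , λ i j u →
          htrans (app-≅ {F.F₀ i} {F.F₀ j} (F.F₁ u) (sym (point i y)) (comp-≅ i y q))
         (htrans (hsym (∘-≅ {d.apex} {F.F₀ i} {F.F₀ j} (F.F₁ u) (d.leg i) y q))
         (htrans (fibre-≅ {d.apex} {F.F₀ j} (d.leg-comm u) y q)
                 (hsym (comp-≅ j y q))))

{-# OPTIONS --safe #-}

-- An element of P x is the same thing as a morphism (X , x ≡_) → (X , P) of C′
-- lying over the identity of X.  Hence a compatible family of elements of the
-- Pⱼ xⱼ is a cone in C′ with apex (X , x ≡_) whose legs lie over the given legs
-- πⱼ of the apex (X , P , x), and the universal property of (X , P) in C′ yields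
-- a morphism (X , x ≡_) → (X , P).  It lies over the identity because the πⱼ are
-- jointly monic in C: arrows out of Y can be tested on (Y , ∅) in C′.
module Submission where

open import Level using (Level)
open import Data.Empty.Polymorphic using (⊥; ⊥-elim)
open import Data.Product using (_,_; proj₁; proj₂)
open import Relation.Binary.HeterogeneousEquality using (_≅_; ≅-to-≡; ≡-to-≅; ≡-subst-removable) renaming (sym to hsym; trans to htrans)
open import Relation.Binary.PropositionalEquality using (_≡_; refl; sym; trans; cong; cong-app; subst)
open import Defs

-- Both arrows mediate the same cone, the legs precomposed with `f`.
limit-legs-jointly-monic :
  ∀ {i o h : Level} {J : Category i i} {D : Category o h} {F : Functor J D}
  {c : Cone F} → IsLimit c → let open Category D; open Cone c in
  ∀ {Y} (f g : Hom Y apex) → (∀ j → leg j ∘ f ≡ leg j ∘ g) → f ≡ g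
limit-legs-jointly-monic {D = D} {F} {c} lim {Y} f g e =
  trans (unique d f λ _ → refl) (sym (unique d g λ j → sym (e j)))
  where
    open Category D
    open Cone c
    open IsLimit lim

    d : Cone F
    d = record
      { apex     = Y
      ; leg      = λ j → leg j ∘ f
      ; leg-comm = λ u → trans (sym (assoc _ _ f)) (cong (_∘ f) (leg-comm u))
      }

module _ (ext : FunExt) {ℓ o h : Level} {C : Category o h} (H : Functor C (Sets ℓ)) where
  open ExtendedBase ext H
  private
    module C  = Category C
    module H  = Functor H
    module E  = Category (Elements (H ∘F Vᴴ))
    module Uᴴ = Functor Uᴴ

  -- Discards the transport built into `Uᴴ`, so that fibre elements over provably equal points are
  -- compared without tracking `subst`.
  Uᴴ₁-≅ : ∀ {A B : E.Obj} (m : E.Hom A B) (p : Uᴴ.F₀ A) →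
          Uᴴ.F₁ {A} {B} m p ≅ proj₂ (proj₁ m) (proj₂ A) p
  Uᴴ₁-≅ {B = (_ , Q) , _} (_ , e) p = ≡-subst-removable Q e _

  -- With empty fibres over `Y`, the fibre part of an arrow out of `Y` is vacuous, so cancellation
  -- in `C′` restricts to the base.
  base-legs-jointly-monic :
    ∀ {J : Category ℓ ℓ} {F : Functor J C′} {c : Cone F} → IsLimit c →
    let open Cone c in
    ∀ {Y} (f g : C.Hom Y (proj₁ apex)) →
    (∀ j → proj₁ (leg j) C.∘ f ≡ proj₁ (leg j) C.∘ g) → f ≡ g
  base-legs-jointly-monic {F = F} {c} lim {Y} f g e =
    cong proj₁ (limit-legs-jointly-monic lim {Y , λ _ → ⊥} (f , λ _ → ⊥-elim) (g , λ _ → ⊥-elim)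
      λ j → ExtHom-≡ {Y , λ _ → ⊥} {Functor.F₀ F j} (e j) λ _ ())

  module _ {J : Category ℓ ℓ} (F : Functor J (Elements (H ∘F Vᴴ))) (c : Cone F)
           (lim : IsRelativeLimit (forget (H ∘F Vᴴ)) c) where
    private
      module J = Category J
      module F = Functor F
      module c = Cone c
      module L = IsLimit lim

      X = proj₁ (proj₁ c.apex)
      P = proj₂ (proj₁ c.apex)
      x = proj₂ c.apex

      π : ∀ j → ExtHom (X , P) (proj₁ (F.F₀ j))
      π j = proj₁ (c.leg j)

      Point : ExtObj
      Point = X , (x ≡_)

    -- The transport is there because an arrow over `C.id` has values over `H.F₁ C.id x`, which
    -- equals `x` only propositionally.
    pointAt : P x → ExtHom Point (X , P)
    pointAt p = C.id , λ { _ refl → subst P (sym (cong-app H.F-id x)) p }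

    pointAt-≅ : (p : P x) → proj₂ (pointAt p) x refl ≅ p
    pointAt-≅ p = ≡-subst-removable P _ p

    leg-pointAt-≅ : (p : P x) → ∀ j →
      proj₂ (ext-∘ {Point} {X , P} {proj₁ (F.F₀ j)} (π j) (pointAt p)) x refl
        ≅ Uᴴ.F₁ {c.apex} {F.F₀ j} (c.leg j) p
    leg-pointAt-≅ p j =
      htrans (∘-≅ {Point} {X , P} {proj₁ (F.F₀ j)} (π j) (pointAt p) x refl)
     (htrans (app-≅ {X , P} {proj₁ (F.F₀ j)} (π j) (cong-app H.F-id x) (pointAt-≅ p))
             (hsym (Uᴴ₁-≅ {c.apex} {F.F₀ j} (c.leg j) p)))

    -- This is the uniqueness half: by `leg-pointAt-≅`, the arrows naming `p` and `q` agree after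
    -- every leg, and limit legs in `C′` are jointly monic.
    elements-separated : (p q : P x) →
      (∀ j → Uᴴ.F₁ {c.apex} {F.F₀ j} (c.leg j) p ≡ Uᴴ.F₁ {c.apex} {F.F₀ j} (c.leg j) q) →
      p ≡ q
    elements-separated p q e =
      ≅-to-≡ (htrans (hsym (pointAt-≅ p))
             (htrans (fibre-≅ {Point} {X , P} pointAt-≡ x refl) (pointAt-≅ q)))
      where
        pointAt-≡ : pointAt p ≡ pointAt q
        pointAt-≡ = limit-legs-jointly-monic lim {Point} (pointAt p) (pointAt q) λ j →
          ExtHom-≡ {Point} {proj₁ (F.F₀ j)} refl λ { _ refl →
            htrans (leg-pointAt-≅ p j) (htrans (≡-to-≅ (e j)) (hsym (leg-pointAt-≅ q j))) }

    module _ (a : ∀ j → Uᴴ.F₀ (F.F₀ j))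
             (a-comm : ∀ {j k} (u : J.Hom j k) → Uᴴ.F₁ {F.F₀ j} {F.F₀ k} (F.F₁ u) (a j) ≡ a k) where

      -- The second component of `c.leg j` identifies the image of `x` with the chosen point of
      -- `F.F₀ j`; `a j` is moved back along it.
      familyLeg : ∀ j → ExtHom Point (proj₁ (F.F₀ j))
      familyLeg j = proj₁ (π j) , λ { _ refl → subst (proj₂ (proj₁ (F.F₀ j))) (sym (proj₂ (c.leg j))) (a j) }

      familyLeg-≅ : ∀ j → proj₂ (familyLeg j) x refl ≅ a j
      familyLeg-≅ j = ≡-subst-removable (proj₂ (proj₁ (F.F₀ j))) _ (a j)

      familyCone : Cone (forget (H ∘F Vᴴ) ∘F F)
      familyCone = record
        { apex     = Point
        ; leg      = familyLeg
        ; leg-comm = λ {j} {k} u →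
            -- The base part is inherited from `c`; once transports are dropped, the fibre part is
            -- `a-comm u`.
            ExtHom-≡ {Point} {proj₁ (F.F₀ k)} (cong (λ m → proj₁ (proj₁ m)) (c.leg-comm u)) λ { _ refl →
              htrans (∘-≅ {Point} {proj₁ (F.F₀ j)} {proj₁ (F.F₀ k)} (proj₁ (F.F₁ u)) (familyLeg j) x refl)
             (htrans (app-≅ {proj₁ (F.F₀ j)} {proj₁ (F.F₀ k)} (proj₁ (F.F₁ u)) (proj₂ (c.leg j)) (familyLeg-≅ j))
             (htrans (hsym (Uᴴ₁-≅ {F.F₀ j} {F.F₀ k} (F.F₁ u) (a j)))
             (htrans (≡-to-≅ (a-comm u))
                     (hsym (familyLeg-≅ k))))) }
        }

      private
        m : ExtHom Point (X , P)
        m = L.mediate familyCone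

      -- Each `familyLeg j` lies over the same base arrow as `π j`, so `proj₁ m` and `C.id` have
      -- equal composites with all base legs.
      mediate-over-id : proj₁ m ≡ C.id
      mediate-over-id = base-legs-jointly-monic lim (proj₁ m) C.id λ j →
        trans (cong proj₁ (L.factor familyCone j)) (sym (C.idʳ _))

      mediate-fixes-x : H.F₁ (proj₁ m) x ≡ x
      mediate-fixes-x = trans (cong (λ f → H.F₁ f x) mediate-over-id) (cong-app H.F-id x)

      amalgam : P x
      amalgam = subst P mediate-fixes-x (proj₂ m x refl)

      leg-amalgam : ∀ j → Uᴴ.F₁ {c.apex} {F.F₀ j} (c.leg j) amalgam ≡ a j
      leg-amalgam j = ≅-to-≡
        (htrans (Uᴴ₁-≅ {c.apex} {F.F₀ j} (c.leg j) amalgam)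
        (htrans (app-≅ {X , P} {proj₁ (F.F₀ j)} (π j) (sym mediate-fixes-x)
                  (≡-subst-removable P mediate-fixes-x _))
        (htrans (hsym (∘-≅ {Point} {X , P} {proj₁ (F.F₀ j)} (π j) m x refl))
        (htrans (fibre-≅ {Point} {proj₁ (F.F₀ j)} (L.factor familyCone j) x refl)
                (familyLeg-≅ j)))))

mainTheorem3 : (ext : FunExt) {ℓ o h : Level} (C : Category o h) (C-complete : Complete ℓ C)
    (H : Functor C (Sets ℓ)) → let open ExtendedBase ext H in
    ContinuousRelativeTo (forget (H ∘F Vᴴ)) (C′-complete C-complete) Uᴴ
mainTheorem3 ext C C-complete H J F c lim = record
  { mediate = λ d t → amalgam ext H F c lim (λ j → Cone.leg d j t) (comm d t)
  ; factor  = λ d j → ext λ t → leg-amalgam ext H F c lim (λ j → Cone.leg d j t) (comm d t) j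
  ; unique  = λ d m e → ext λ t → elements-separated ext H F c lim _ _ λ j →
      trans (cong-app (e j) t)
            (sym (leg-amalgam ext H F c lim (λ j → Cone.leg d j t) (comm d t) j))
  }
  where
    open ExtendedBase ext H using (Uᴴ)

    comm : (d : Cone (Uᴴ ∘F F)) (t : Cone.apex d) → ∀ {j k} (u : Category.Hom J j k) →
           Functor.F₁ (Uᴴ ∘F F) u (Cone.leg d j t) ≡ Cone.leg d k t
    comm d t u = cong-app (Cone.leg-comm d u) t
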